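{- For $d\ge 1$ let $M_d$ be the maximal cardinality of a neighborly $d$-code without twin pairs. Then $$\lim_{d\rightarrow\infty}\left(2^{d}-M_d\right)=\infty .$$
   Context: Let $A=\{0,1,*\}$, and for a positive integer $n$ let $A^n$ be the set of all words $v=v_1\ldots v_n$ with $v_i\in A$ for $i\in[n]=\{1,\ldots,n\}$. For $v\in A^n$ put $\operatorname{prop}(v)=\{i\in[n]\colon v_i\neq *\}$. Two words $v,u\in A^n$ are dichotomous at the $i$-th position if $v_i,u_i\in\{0,1\}$ and $v_i+u_i=1$; they are dichotomous if this holds for some $i\in[n]$, and neighborly if there is precisely one such $i$. Two neighborly words $v,w\in A^n$, with $i$ the unique position at which they are dichotomous, form a twin pair if $w_j=v_j$ for all $j\in[n]\setminus\{i\}$. A set $V\subset A^n$ is a code if every two distinct words in $V$ are dichotomous, and a neighborly code if every two distinct words in $V$ are neighborly. For an integer $d\ge 1$, a code $V\subset A^n$ is a $d$-code if $|\operatorname{prop}(v)|=d$ for every $v\in V$; a neighborly $d$-code is a $d$-code which is a neighborly code. "Without twin pairs" means that no two words of $V$ form a twin pair. In the definition of $M_d$ the maximum is taken over all neighborly $d$-codes $V\subset A^n$ without twin pairs, where the length $n$ is an arbitrary positive integer (every $d$-code has at most $2^d$ words, so $M_d$ is well defined). -}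

module Defs where

open import Data.Bool.Base using (Bool; true; false)
open import Data.Fin.Base using (Fin)
open import Data.Fin.Subset using (Subset; ∣_∣)
open import Data.Integer.Base as ℤ using (ℤ)
open import Data.List.Base using (List; length)
open import Data.List.Membership.Propositional using (_∈_)
open import Data.List.Relation.Unary.Unique.Propositional using (Unique)
open import Data.Nat.Base using (ℕ; _≤_)
open import Data.Product using (Σ; ∃; ∃₂; ∃!; _×_; _,_)
open import Data.Vec.Base using (Vec; lookup; map)
open import Relation.Binary.PropositionalEquality.Core using (_≡_; _≢_)
open import Relation.Nullary.Negation.Core using (¬_)

data Letter : Set where
  𝟎 𝟏 ∗ : Letter

Word : ℕ → Set
Word n = Vec Letter n

-- The indicator of a ≠ ∗.
proper : Letter → Bool
proper 𝟎 = true
proper 𝟏 = true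
proper ∗ = false

prop : ∀ {n} → Word n → Subset n
prop = map proper

-- a , b ∈ {0,1} and a + b = 1.
data Opposite : Letter → Letter → Set where
  𝟎𝟏 : Opposite 𝟎 𝟏
  𝟏𝟎 : Opposite 𝟏 𝟎

DichotomousAt : ∀ {n} → Word n → Word n → Fin n → Set
DichotomousAt v u i = Opposite (lookup v i) (lookup u i)

Dichotomous : ∀ {n} → Word n → Word n → Set
Dichotomous v u = ∃ (DichotomousAt v u)

Neighborly : ∀ {n} → Word n → Word n → Set
Neighborly v u = ∃! _≡_ (DichotomousAt v u)

TwinPair : ∀ {n} → Word n → Word n → Set
TwinPair v w =
  Σ (Neighborly v w) λ (i , _) → ∀ j → j ≢ i → lookup w j ≡ lookup v j

-- A set of words is represented by a list, used below only together with
-- Unique, so that length is its cardinality.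

IsCode : ∀ {n} → List (Word n) → Set
IsCode V = ∀ {v w} → v ∈ V → w ∈ V → v ≢ w → Dichotomous v w

IsNeighborlyCode : ∀ {n} → List (Word n) → Set
IsNeighborlyCode V = ∀ {v w} → v ∈ V → w ∈ V → v ≢ w → Neighborly v w

IsDCode : ∀ {n} → ℕ → List (Word n) → Set
IsDCode d V = IsCode V × (∀ {v} → v ∈ V → ∣ prop v ∣ ≡ d)

WithoutTwinPairs : ∀ {n} → List (Word n) → Set
WithoutTwinPairs V = ∀ {v w} → v ∈ V → w ∈ V → ¬ TwinPair v w

record IsTwinFreeNeighborlyDCode (d n : ℕ) (V : List (Word n)) : Set where
  field
    positive         : 1 ≤ n
    unique           : Unique V
    dCode            : IsDCode d V
    neighborlyCode   : IsNeighborlyCode V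
    withoutTwinPairs : WithoutTwinPairs V

-- m is the maximum of the cardinalities, over all lengths n.
record IsMaximalCardinality (d m : ℕ) : Set where
  field
    attained   : ∃₂ λ n V → IsTwinFreeNeighborlyDCode d n V × length V ≡ m
    upperBound : ∀ {n V} → IsTwinFreeNeighborlyDCode d n V → length V ≤ m

TendsToInfinity : (ℕ → ℤ) → Set
TendsToInfinity f = ∀ (K : ℤ) → ∃ λ D → ∀ d → D ≤ d → K ℤ.≤ f d

{-# OPTIONS --safe #-}
module Submission where

-- A word v is the box of all x ∈ {0,1}ⁿ agreeing with v on prop v; a d-code is
-- a family of N disjoint boxes of volume 2^(n−d). Let X be the set of uncovered
-- points, so that |X| = k 2^(n−d) with k = 2^d − N.
--
-- Neighborly words with the same proper positions are twins, so the sets prop v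
-- are distinct. Hence for v ∈ V each of the 2^(n−d) fibres obtained by varying
-- the positions in S = prop v meets every box other than v in an even number of
-- points, and v in exactly one; it contains an odd number of points of X, and
-- therefore an edge in direction i leaving X, for each i ∈ S. So X has at least
-- 2^(n−d) boundary edges in every direction i that occurs in the code.
--
-- On the other hand, a point x ∈ X has at most 2d covered neighbours: if v and w
-- cover the neighbours in directions i and j, then v and w are dichotomous at i
-- or at j, so that j ∈ prop v or i ∈ prop w, and one counts arcs (i, j). Thus at
-- most 2dk directions occur.
--
-- Let sᵢ be the number of words with i ∈ prop v. Then ∑ sᵢ = dN, while ∑ sᵢ² is
-- at most N (dk + 2N): halving the cube at i shows that 0 and 1 occur at i
-- equally often up to k, and the pairs with opposite letters are counted by
-- neighborliness. Cauchy–Schwarz over the occurring directions gives d ≤ 6k as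
-- soon as dk ≤ N.

open import Data.Bool.Base using (Bool; true; false; not)
open import Data.Bool.Properties using (not-involutive)
open import Data.Empty using (⊥; ⊥-elim)
open import Data.Fin.Base using (Fin; zero; suc)
import Data.Fin.Properties as Fin
open import Data.Fin.Subset using (∣_∣)
import Data.Integer.Base as ℤ
import Data.Integer.Properties as ℤ
open import Data.List.Base using (List; []; _∷_; _++_; length; allFin) renaming (map to mapᴸ)
open import Data.List.Membership.Propositional using (_∈_)
open import Data.List.Membership.Propositional.Properties using (∈-allFin)
open import Data.List.Properties using (map-tabulate)
open import Data.List.Relation.Unary.All using () renaming (lookup to All-lookup)
open import Data.List.Relation.Unary.AllPairs using ([]; _∷_)
open import Data.List.Relation.Unary.Any using (here; there)
open import Data.List.Relation.Unary.Unique.Propositional using (Unique)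
open import Data.List.Relation.Unary.Unique.Propositional.Properties using (allFin⁺)
open import Data.Nat.Base
open import Data.Nat.Divisibility using (_∣_; divides; ∣m∣n⇒∣m+n; ∣m+n∣m⇒∣n; _∣0; >⇒∤)
open import Data.Nat.Properties
open import Data.Nat.Tactic.RingSolver using (solve-∀)
open import Data.Product.Base using (∃; _×_; _,_; proj₁; proj₂)
open import Data.Sum.Base using (_⊎_; inj₁; inj₂)
open import Data.Vec.Base using (Vec; []; _∷_; lookup; updateAt; _[_]≔_)
open import Data.Vec.Properties
  using (≡-dec; lookup∘updateAt′; updateAt-updateAt-local; updateAt-id)
open import Function.Base using (_∘_)
open import Relation.Binary.Definitions using (DecidableEquality)
open import Relation.Binary.PropositionalEquality
open import Relation.Nullary using (¬_; yes; no; contradiction)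
open import Relation.Nullary.Decidable using (_×-dec_)

open import Defs

private variable
  A B : Set

-- Finite sums over lists, with parity.

∑ : List A → (A → ℕ) → ℕ
∑ []       f = 0
∑ (x ∷ xs) f = f x + ∑ xs f

infixr 8 ∑
syntax ∑ xs (λ x → e) = ∑[ x ← xs ] e

∑-mono : ∀ (xs : List A) {f g} → (∀ {x} → x ∈ xs → f x ≤ g x) → ∑ xs f ≤ ∑ xs g
∑-mono []       f≤g = z≤n
∑-mono (x ∷ xs) f≤g = +-mono-≤ (f≤g (here refl)) (∑-mono xs (f≤g ∘ there))

∑-cong : ∀ (xs : List A) {f g} → (∀ {x} → x ∈ xs → f x ≡ g x) → ∑ xs f ≡ ∑ xs g
∑-cong []       f≡g = refl
∑-cong (x ∷ xs) f≡g = cong₂ _+_ (f≡g (here refl)) (∑-cong xs (f≡g ∘ there))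

∑-+ : ∀ (xs : List A) f g → ∑[ x ← xs ] (f x + g x) ≡ ∑ xs f + ∑ xs g
∑-+ []       f g = refl
∑-+ (x ∷ xs) f g = trans (cong (f x + g x +_) (∑-+ xs f g)) (lemma (f x) (g x) (∑ xs f) (∑ xs g))
  where
  lemma : ∀ a b c d → a + b + (c + d) ≡ a + c + (b + d)
  lemma = solve-∀

∑-*ˡ : ∀ c (xs : List A) f → ∑[ x ← xs ] (c * f x) ≡ c * ∑ xs f
∑-*ˡ c []       f = sym (*-zeroʳ c)
∑-*ˡ c (x ∷ xs) f = trans (cong (c * f x +_) (∑-*ˡ c xs f)) (sym (*-distribˡ-+ c (f x) (∑ xs f)))

∑-*ʳ : ∀ c (xs : List A) f → ∑[ x ← xs ] (f x * c) ≡ ∑ xs f * c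
∑-*ʳ c xs f =
  trans (∑-cong xs λ {x} _ → *-comm (f x) c) (trans (∑-*ˡ c xs f) (*-comm c (∑ xs f)))

∑-const : ∀ c (xs : List A) → ∑[ _ ← xs ] c ≡ length xs * c
∑-const c []       = refl
∑-const c (x ∷ xs) = cong (c +_) (∑-const c xs)

∑-swap : ∀ (xs : List A) (ys : List B) (f : A → B → ℕ) →
         ∑[ x ← xs ] ∑[ y ← ys ] f x y ≡ ∑[ y ← ys ] ∑[ x ← xs ] f x y
∑-swap []       ys f = sym (trans (∑-const 0 ys) (*-zeroʳ (length ys)))
∑-swap (x ∷ xs) ys f =
  trans (cong (∑ ys (f x) +_) (∑-swap xs ys f)) (sym (∑-+ ys (f x) _))

∈⇒≤∑ : ∀ {xs : List A} f {x} → x ∈ xs → f x ≤ ∑ xs f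
∈⇒≤∑ f (here refl) = m≤m+n _ _
∈⇒≤∑ f (there x∈)  = ≤-trans (∈⇒≤∑ f x∈) (m≤n+m _ _)

∑-pos : ∀ (xs : List A) f → 0 < ∑ xs f → ∃ λ x → x ∈ xs × 0 < f x
∑-pos (x ∷ xs) f pos with f x in eq
... | suc _ = x , here refl , subst (0 <_) (sym eq) z<s
... | zero  = let y , y∈ , fy = ∑-pos xs f pos in y , there y∈ , fy

∑-zero : ∀ (xs : List A) f → (∀ {x} → x ∈ xs → f x ≡ 0) → ∑ xs f ≡ 0
∑-zero []       f f≡0 = refl
∑-zero (x ∷ xs) f f≡0 = cong₂ _+_ (f≡0 (here refl)) (∑-zero xs f (f≡0 ∘ there))

∑≤1 : ∀ {xs : List A} f → Unique xs → (∀ x → f x ≤ 1) →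
      (∀ {x y} → x ∈ xs → y ∈ xs → 0 < f x → 0 < f y → x ≡ y) → ∑ xs f ≤ 1
∑≤1 {xs = []}     f []             f≤1 single = z≤n
∑≤1 {xs = x ∷ xs} f (x∉xs ∷ uniq) f≤1 single with f x in eq
... | zero  = ∑≤1 f uniq f≤1 λ y∈ z∈ → single (there y∈) (there z∈)
... | suc m = begin
    suc m + ∑ xs f ≡⟨ cong (suc m +_) (∑-zero xs f rest) ⟩
    suc m + 0      ≡⟨ +-identityʳ _ ⟩
    suc m          ≡⟨ eq ⟨
    f x            ≤⟨ f≤1 x ⟩
    1              ∎
  where
  open ≤-Reasoning
  rest : ∀ {y} → y ∈ xs → f y ≡ 0
  rest {y} y∈ with f y in eq′
  ... | zero  = refl
  ... | suc _ = contradiction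
    (single (here refl) (there y∈) (subst (0 <_) (sym eq) z<s) (subst (0 <_) (sym eq′) z<s))
    (All-lookup x∉xs y∈)

∑-strict : ∀ {xs : List A} {f g} → (∀ x → f x ≤ g x) → ∀ {x} → x ∈ xs → f x < g x → ∑ xs f < ∑ xs g
∑-strict {xs = _ ∷ xs} f≤g (here refl) fx<gx = +-mono-<-≤ fx<gx (∑-mono xs λ {y} _ → f≤g y)
∑-strict {xs = y ∷ _}  f≤g (there x∈)  fx<gx = +-mono-≤-< (f≤g y) (∑-strict f≤g x∈ fx<gx)

∑-even : ∀ (xs : List A) f → (∀ {x} → x ∈ xs → 2 ∣ f x) → 2 ∣ ∑ xs f
∑-even []       f even = 2 ∣0
∑-even (x ∷ xs) f even = ∣m∣n⇒∣m+n (even (here refl)) (∑-even xs f (even ∘ there))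

∑-odd : ∀ {xs : List A} f {x} → Unique xs → x ∈ xs → f x ≡ 1 →
        (∀ {y} → y ∈ xs → x ≢ y → 2 ∣ f y) → ¬ 2 ∣ ∑ xs f
∑-odd {xs = x ∷ xs} f (x∉xs ∷ _) (here refl) fx≡1 even 2∣∑ =
  >⇒∤ (s≤s (s≤s z≤n)) (subst (2 ∣_) fx≡1
    (∣m+n∣m⇒∣n (subst (2 ∣_) (+-comm (f x) _) 2∣∑)
      (∑-even xs f λ y∈ → even (there y∈) (All-lookup x∉xs y∈))))
∑-odd f (y∉ys ∷ uniq) (there x∈) fx≡1 even 2∣∑ =
  ∑-odd f uniq x∈ fx≡1 (even ∘ there)
    (∣m+n∣m⇒∣n 2∣∑ (even (here refl) (All-lookup y∉ys x∈ ∘ sym)))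

∑-map : ∀ (h : A → B) xs f → ∑ (mapᴸ h xs) f ≡ ∑ xs (f ∘ h)
∑-map h []       f = refl
∑-map h (x ∷ xs) f = cong (f (h x) +_) (∑-map h xs f)

∑-++ : ∀ (xs ys : List A) f → ∑ (xs ++ ys) f ≡ ∑ xs f + ∑ ys f
∑-++ []       ys f = refl
∑-++ (x ∷ xs) ys f = trans (cong (f x +_) (∑-++ xs ys f)) (sym (+-assoc (f x) _ _))

∑-allFin-suc : ∀ n f → ∑ (allFin (suc n)) f ≡ f zero + ∑[ i ← allFin n ] f (suc i)
∑-allFin-suc n f = cong (f zero +_)
  (trans (cong (λ is → ∑ is f) (sym (map-tabulate (λ i → i) suc))) (∑-map suc (allFin n) f))

-- The cube of points, its flips and its product sums.

Point : ℕ → Set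
Point = Vec Bool

cube : ∀ n → List (Point n)
cube zero    = [] ∷ []
cube (suc n) = mapᴸ (false ∷_) (cube n) ++ mapᴸ (true ∷_) (cube n)

∑-cube-suc : ∀ n F → ∑ (cube (suc n)) F ≡
             ∑[ x ← cube n ] F (false ∷ x) + ∑[ x ← cube n ] F (true ∷ x)
∑-cube-suc n F = trans
  (∑-++ (mapᴸ (false ∷_) (cube n)) (mapᴸ (true ∷_) (cube n)) F)
  (cong₂ _+_ (∑-map (false ∷_) (cube n) F) (∑-map (true ∷_) (cube n) F))

cube-volume : ∀ n → ∑[ _ ← cube n ] 1 ≡ 2 ^ n
cube-volume zero    = refl
cube-volume (suc n) = trans (∑-cube-suc n _)
  (cong₂ _+_ (cube-volume n) (trans (cube-volume n) (sym (+-identityʳ _))))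

≤∑-cube : ∀ {n} F (x : Point n) → F x ≤ ∑ (cube n) F
≤∑-cube F []          = m≤m+n _ _
≤∑-cube {suc n} F (false ∷ x) = ≤-trans (≤∑-cube (F ∘ (false ∷_)) x)
  (≤-trans (m≤m+n _ _) (≤-reflexive (sym (∑-cube-suc n F))))
≤∑-cube {suc n} F (true ∷ x)  = ≤-trans (≤∑-cube (F ∘ (true ∷_)) x)
  (≤-trans (m≤n+m _ _) (≤-reflexive (sym (∑-cube-suc n F))))

flip : ∀ {n} → Fin n → Point n → Point n
flip i x = updateAt x i not

flip-involutive : ∀ {n} i (x : Point n) → flip i (flip i x) ≡ x
flip-involutive i x =
  trans (updateAt-updateAt-local i {h = λ b → b} x (not-involutive _)) (updateAt-id i x)

-- The flip exchanges the halves `xᵢ = 0` and `xᵢ = 1`, so both have the same sum; the recursion on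
-- `i` only strips the coordinates before it.
flip-invariant⇒even : ∀ {n} i (F : Point n → ℕ) → (∀ x → F (flip i x) ≡ F x) → 2 ∣ ∑ (cube n) F
flip-invariant⇒even {suc n} zero F inv = divides (∑[ x ← cube n ] F (true ∷ x)) (begin
  ∑ (cube (suc n)) F                                          ≡⟨ ∑-cube-suc n F ⟩
  ∑[ x ← cube n ] F (false ∷ x) + ∑[ x ← cube n ] F (true ∷ x)
    ≡⟨ cong (_+ s) (∑-cong (cube n) λ {x} _ → inv (true ∷ x)) ⟩
  s + s                                                       ≡⟨ double s ⟩
  s * 2                                                       ∎)
  where
  open ≡-Reasoning
  s = ∑[ x ← cube n ] F (true ∷ x)
  double : ∀ a → a + a ≡ a * 2
  double = solve-∀
flip-invariant⇒even {suc n} (suc i) F inv = subst (2 ∣_) (sym (∑-cube-suc n F))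
  (∣m∣n⇒∣m+n (flip-invariant⇒even i _ λ x → inv (false ∷ x))
             (flip-invariant⇒even i _ λ x → inv (true ∷ x)))

-- The induction step for every volume below: the indicators are products over the coordinates, so
-- the first coordinate splits off as a factor.
∑-cube-product : ∀ {n} (k : Bool → ℕ) (F : Point n → ℕ) {G} → (∀ b x → G (b ∷ x) ≡ k b * F x) →
                 ∑ (cube (suc n)) G ≡ (k false + k true) * ∑ (cube n) F
∑-cube-product {n} k F {G} G≡ = begin
  ∑ (cube (suc n)) G                       ≡⟨ ∑-cube-suc n G ⟩
  ∑ (cube n) (G ∘ (false ∷_)) + ∑ (cube n) (G ∘ (true ∷_))
                                           ≡⟨ cong₂ _+_ (half false) (half true) ⟩
  k false * ∑ (cube n) F + k true * ∑ (cube n) F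
                                           ≡⟨ *-distribʳ-+ (∑ (cube n) F) (k false) (k true) ⟨
  (k false + k true) * ∑ (cube n) F        ∎
  where
  open ≡-Reasoning
  half : ∀ b → ∑ (cube n) (G ∘ (b ∷_)) ≡ k b * ∑ (cube n) F
  half b = trans (∑-cong (cube n) λ {x} _ → G≡ b x) (∑-*ˡ (k b) (cube n) F)

-- Words as boxes: indicators, fibres and volumes.

_≟ᴸ_ : DecidableEquality Letter
𝟎 ≟ᴸ 𝟎 = yes refl
𝟎 ≟ᴸ 𝟏 = no λ()
𝟎 ≟ᴸ ∗ = no λ()
𝟏 ≟ᴸ 𝟎 = no λ()
𝟏 ≟ᴸ 𝟏 = yes refl
𝟏 ≟ᴸ ∗ = no λ()
∗ ≟ᴸ 𝟎 = no λ()
∗ ≟ᴸ 𝟏 = no λ()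
∗ ≟ᴸ ∗ = yes refl

compat : Letter → Bool → ℕ
compat 𝟎 false = 1
compat 𝟎 true  = 0
compat 𝟏 false = 0
compat 𝟏 true  = 1
compat ∗ _     = 1

fixed : Letter → ℕ
fixed 𝟎 = 1
fixed 𝟏 = 1
fixed ∗ = 0

opposite : Letter → Letter → ℕ
opposite 𝟎 𝟏 = 1
opposite 𝟏 𝟎 = 1
opposite _ _ = 0

-- The value at ∗ is junk.
bit : Letter → Bool
bit 𝟎 = false
bit 𝟏 = true
bit ∗ = false

same : Bool → Bool → ℕ
same false false = 1
same false true  = 0
same true  false = 0
same true  true  = 1

agree : Letter → Bool → Bool → ℕ
agree 𝟎 _ _ = 1
agree 𝟏 _ _ = 1
agree ∗ a b = same a b

χ : ∀ {n} → Word n → Point n → ℕ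
χ []      []      = 1
χ (a ∷ v) (b ∷ x) = compat a b * χ v x

-- The indicator of z and x agreeing outside prop v.
off : ∀ {n} → Word n → Point n → Point n → ℕ
off []      []      []      = 1
off (c ∷ v) (a ∷ z) (b ∷ x) = agree c a b * off v z x

compat≤1 : ∀ a b → compat a b ≤ 1
compat≤1 𝟎 false = ≤-refl
compat≤1 𝟎 true  = z≤n
compat≤1 𝟏 false = z≤n
compat≤1 𝟏 true  = ≤-refl
compat≤1 ∗ _     = ≤-refl

χ≤1 : ∀ {n} (v : Word n) x → χ v x ≤ 1
χ≤1 []      []      = ≤-refl
χ≤1 (a ∷ v) (b ∷ x) = *-mono-≤ (compat≤1 a b) (χ≤1 v x)

*-posˡ : ∀ m {n} → 0 < m * n → 0 < m
*-posˡ (suc _) _ = z<s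

*-posʳ : ∀ m {n} → 0 < m * n → 0 < n
*-posʳ m {n} 0<mn = *-posˡ n (subst (0 <_) (*-comm m n) 0<mn)

χ-pos : ∀ {n} (v : Word n) x → 0 < χ v x → ∀ i → 0 < compat (lookup v i) (lookup x i)
χ-pos (a ∷ v) (b ∷ x) pos zero    = *-posˡ (compat a b) pos
χ-pos (a ∷ v) (b ∷ x) pos (suc i) = χ-pos v x (*-posʳ (compat a b) pos) i

χ-flip : ∀ {n} i (v : Word n) x → lookup v i ≡ ∗ → χ v (flip i x) ≡ χ v x
χ-flip zero    (∗ ∷ v) (b ∷ x) refl = refl
χ-flip (suc i) (a ∷ v) (b ∷ x) eq   = cong (compat a b *_) (χ-flip i v x eq)

off-flip : ∀ {n} i (v : Word n) z x → 0 < fixed (lookup v i) → off v z (flip i x) ≡ off v z x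
off-flip zero    (𝟎 ∷ v) (a ∷ z) (b ∷ x) _ = refl
off-flip zero    (𝟏 ∷ v) (a ∷ z) (b ∷ x) _ = refl
off-flip (suc i) (c ∷ v) (a ∷ z) (b ∷ x) p = cong (agree c a b *_) (off-flip i v z x p)

agree-sym : ∀ c a b → agree c a b ≡ agree c b a
agree-sym 𝟎 _     _     = refl
agree-sym 𝟏 _     _     = refl
agree-sym ∗ false false = refl
agree-sym ∗ false true  = refl
agree-sym ∗ true  false = refl
agree-sym ∗ true  true  = refl

off-sym : ∀ {n} (v : Word n) z x → off v z x ≡ off v x z
off-sym []      []      []      = refl
off-sym (c ∷ v) (a ∷ z) (b ∷ x) = cong₂ _*_ (agree-sym c a b) (off-sym v z x)

*-interchange : ∀ a b c d → a * b * (c * d) ≡ a * c * (b * d)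
*-interchange = solve-∀

-- The fibre through `z` leaves exactly the positions of `prop v` free, and these are the ones that
-- the box of `v` prescribes; so the two meet in a single point.
∑-χ-off : ∀ {n} (v : Word n) z → ∑[ x ← cube n ] (χ v x * off v z x) ≡ 1
∑-χ-off []      []      = refl
∑-χ-off (c ∷ v) (a ∷ z) = trans
  (∑-cube-product (λ b → compat c b * agree c a b) (λ x → χ v x * off v z x)
    λ b x → *-interchange (compat c b) (χ v x) (agree c a b) (off v z x))
  (cong₂ _*_ (factor c a) (∑-χ-off v z))
  where
  factor : ∀ c a → compat c false * agree c a false + compat c true * agree c a true ≡ 1
  factor 𝟎 _     = refl
  factor 𝟏 _     = refl
  factor ∗ false = refl
  factor ∗ true  = refl

∣prop∣-suc : ∀ {n} c (v : Word n) → ∣ prop (c ∷ v) ∣ ≡ fixed c + ∣ prop v ∣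
∣prop∣-suc 𝟎 v = refl
∣prop∣-suc 𝟏 v = refl
∣prop∣-suc ∗ v = refl

∑-fixed : ∀ {n} (v : Word n) → ∑[ i ← allFin n ] fixed (lookup v i) ≡ ∣ prop v ∣
∑-fixed []      = refl
∑-fixed {suc n} (c ∷ v) = trans (∑-allFin-suc n (λ i → fixed (lookup (c ∷ v) i)))
  (trans (cong (fixed c +_) (∑-fixed v)) (sym (∣prop∣-suc c v)))

compat-mean : ∀ c → (compat c false + compat c true) * 2 ^ fixed c ≡ 2
compat-mean 𝟎 = refl
compat-mean 𝟏 = refl
compat-mean ∗ = refl

2^∣prop∣-suc : ∀ {n} c (v : Word n) → 2 ^ ∣ prop (c ∷ v) ∣ ≡ 2 ^ fixed c * 2 ^ ∣ prop v ∣
2^∣prop∣-suc c v = trans (cong (2 ^_) (∣prop∣-suc c v)) (^-distribˡ-+-* 2 (fixed c) ∣ prop v ∣)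

χ-volume : ∀ {n} (v : Word n) → ∑ (cube n) (χ v) * 2 ^ ∣ prop v ∣ ≡ 2 ^ n
χ-volume []      = refl
χ-volume {suc n} (c ∷ v) = begin
  ∑ (cube (suc n)) (χ (c ∷ v)) * 2 ^ ∣ prop (c ∷ v) ∣
    ≡⟨ cong₂ _*_ (∑-cube-product (compat c) (χ v) λ _ _ → refl) (2^∣prop∣-suc c v) ⟩
  (compat c false + compat c true) * ∑ (cube n) (χ v) * (2 ^ fixed c * 2 ^ ∣ prop v ∣)
    ≡⟨ *-interchange (compat c false + compat c true) (∑ (cube n) (χ v)) (2 ^ fixed c) _ ⟩
  (compat c false + compat c true) * 2 ^ fixed c * (∑ (cube n) (χ v) * 2 ^ ∣ prop v ∣)
    ≡⟨ cong₂ _*_ (compat-mean c) (χ-volume v) ⟩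
  2 * 2 ^ n ∎
  where open ≡-Reasoning

-- Overwriting coordinate `i` by `b` visits each point of the half-cube `xᵢ = b` twice, so this is
-- twice the volume of the box inside that half. No cube of lower dimension is involved.
χ-half-volume : ∀ {n} i b (v : Word n) →
  ∑[ x ← cube n ] χ v (x [ i ]≔ b) * 2 ^ ∣ prop v ∣ ≡
  compat (lookup v i) b * 2 ^ fixed (lookup v i) * 2 ^ n
χ-half-volume {suc n} zero b (c ∷ v) = begin
  ∑[ x ← cube (suc n) ] χ (c ∷ v) (x [ zero ]≔ b) * 2 ^ ∣ prop (c ∷ v) ∣
    ≡⟨ cong₂ _*_ (∑-cube-product (λ _ → compat c b) (χ v) λ _ _ → refl) (2^∣prop∣-suc c v) ⟩
  (compat c b + compat c b) * S * (2 ^ fixed c * 2 ^ ∣ prop v ∣)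
    ≡⟨ lemma (compat c b) S (2 ^ fixed c) (2 ^ ∣ prop v ∣) ⟩
  compat c b * 2 ^ fixed c * (2 * (S * 2 ^ ∣ prop v ∣))
    ≡⟨ cong (λ t → compat c b * 2 ^ fixed c * (2 * t)) (χ-volume v) ⟩
  compat c b * 2 ^ fixed c * (2 * 2 ^ n) ∎
  where
  open ≡-Reasoning
  S = ∑ (cube n) (χ v)
  lemma : ∀ a s p q → (a + a) * s * (p * q) ≡ a * p * (2 * (s * q))
  lemma = solve-∀
χ-half-volume {suc n} (suc i) b (c ∷ v) = begin
  ∑[ x ← cube (suc n) ] χ (c ∷ v) (x [ suc i ]≔ b) * 2 ^ ∣ prop (c ∷ v) ∣
    ≡⟨ cong₂ _*_ (∑-cube-product (compat c) (λ x → χ v (x [ i ]≔ b)) λ _ _ → refl) (2^∣prop∣-suc c v) ⟩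
  (compat c false + compat c true) * S * (2 ^ fixed c * 2 ^ ∣ prop v ∣)
    ≡⟨ *-interchange (compat c false + compat c true) S (2 ^ fixed c) (2 ^ ∣ prop v ∣) ⟩
  (compat c false + compat c true) * 2 ^ fixed c * (S * 2 ^ ∣ prop v ∣)
    ≡⟨ cong₂ _*_ (compat-mean c) (χ-half-volume i b v) ⟩
  2 * (w * 2 ^ n)
    ≡⟨ lemma w (2 ^ n) ⟩
  w * (2 * 2 ^ n) ∎
  where
  open ≡-Reasoning
  S = ∑[ x ← cube n ] χ v (x [ i ]≔ b)
  w = compat (lookup v i) b * 2 ^ fixed (lookup v i)
  lemma : ∀ a p → 2 * (a * p) ≡ a * (2 * p)
  lemma = solve-∀

-- Comparing two words: opposite letters and proper positions.

-- The product `compat c (bit a) * 2 ^ fixed c` is 2, 0 or 1 as `c` equals `a`, is opposite to it or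
-- is `∗`, while `fixed c + 1` is 2, 2 or 1. Summed over the code, this turns a half-cube volume
-- into a count of opposite letters.
opposite-count : ∀ a c → 0 < fixed a →
                 fixed c + 1 ≡ compat c (bit a) * 2 ^ fixed c + 2 * opposite a c
opposite-count 𝟎 𝟎 _ = refl
opposite-count 𝟎 𝟏 _ = refl
opposite-count 𝟎 ∗ _ = refl
opposite-count 𝟏 𝟎 _ = refl
opposite-count 𝟏 𝟏 _ = refl
opposite-count 𝟏 ∗ _ = refl

opposite≤1 : ∀ a b → opposite a b ≤ 1
opposite≤1 𝟎 𝟎 = z≤n
opposite≤1 𝟎 𝟏 = ≤-refl
opposite≤1 𝟎 ∗ = z≤n
opposite≤1 𝟏 𝟎 = ≤-refl
opposite≤1 𝟏 𝟏 = z≤n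
opposite≤1 𝟏 ∗ = z≤n
opposite≤1 ∗ _ = z≤n

opposite-pos : ∀ a b → 0 < opposite a b → Opposite a b
opposite-pos 𝟎 𝟏 _ = 𝟎𝟏
opposite-pos 𝟏 𝟎 _ = 𝟏𝟎

opposite-irrefl : ∀ a → ¬ Opposite a a
opposite-irrefl 𝟎 ()
opposite-irrefl 𝟏 ()
opposite-irrefl ∗ ()

opposite⇒¬compat : ∀ {a c} b → Opposite a c → 0 < compat a b → 0 < compat c b → ⊥
opposite⇒¬compat false 𝟎𝟏 _ ()
opposite⇒¬compat false 𝟏𝟎 () _
opposite⇒¬compat true  𝟎𝟏 () _
opposite⇒¬compat true  𝟏𝟎 _ ()

opposite⇒fixed : ∀ {a c} → Opposite a c → 0 < fixed a × 0 < fixed c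
opposite⇒fixed 𝟎𝟏 = z<s , z<s
opposite⇒fixed 𝟏𝟎 = z<s , z<s

-- Without such a position, `prop v` lies in `prop w`, and equal sizes make them equal. Then the
-- words can differ only where they are opposite, which is at `i` alone, and they form a twin pair.
prop-differ : ∀ {n} {v w : Word n} → ∣ prop v ∣ ≡ ∣ prop w ∣ → Neighborly v w → ¬ TwinPair v w →
              ∃ λ j → 0 < fixed (lookup v j) × lookup w j ≡ ∗
prop-differ {n} {v} {w} size nb@(i , _ , unique) ¬twin
  with Fin.any? (λ j → (0 <? fixed (lookup v j)) ×-dec (lookup w j ≟ᴸ ∗))
... | yes found = found
... | no  none  = contradiction (nb , λ j j≢i → letters≡ j λ opp → j≢i (sym (unique opp))) ¬twin
  where
  cases : ∀ a b → ¬ (0 < fixed a × b ≡ ∗) → fixed a ≤ fixed b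
  cases 𝟎 𝟎 _ = ≤-refl
  cases 𝟎 𝟏 _ = ≤-refl
  cases 𝟎 ∗ h = contradiction (z<s , refl) h
  cases 𝟏 𝟎 _ = ≤-refl
  cases 𝟏 𝟏 _ = ≤-refl
  cases 𝟏 ∗ h = contradiction (z<s , refl) h
  cases ∗ _ _ = z≤n

  fixed≤ : ∀ j → fixed (lookup v j) ≤ fixed (lookup w j)
  fixed≤ j = cases _ _ λ p → none (j , p)

  fixed≮ : ∀ j → ¬ fixed (lookup v j) < fixed (lookup w j)
  fixed≮ j lt = <⇒≢ (∑-strict fixed≤ (∈-allFin j) lt)
    (trans (∑-fixed v) (trans size (sym (∑-fixed w))))

  letters≡ : ∀ j → ¬ Opposite (lookup v j) (lookup w j) → lookup w j ≡ lookup v j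
  letters≡ j ¬opp with lookup v j | lookup w j | fixed≤ j | fixed≮ j
  ... | 𝟎 | 𝟎 | _ | _ = refl
  ... | 𝟎 | 𝟏 | _ | _ = contradiction 𝟎𝟏 ¬opp
  ... | 𝟏 | 𝟎 | _ | _ = contradiction 𝟏𝟎 ¬opp
  ... | 𝟏 | 𝟏 | _ | _ = refl
  ... | ∗ | 𝟎 | _ | h = contradiction z<s h
  ... | ∗ | 𝟏 | _ | h = contradiction z<s h
  ... | ∗ | ∗ | _ | _ = refl

∑-pos⁺ : ∀ {xs : List A} f {x} → x ∈ xs → 0 < f x → 0 < ∑ xs f
∑-pos⁺ f x∈ pos = <-≤-trans pos (∈⇒≤∑ f x∈)

indicator-*-≤ : ∀ {a b c} → a ≤ 1 → b ≤ 1 → (0 < a → 0 < b → 0 < c) → a * b ≤ c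
indicator-*-≤ z≤n       _         _ = z≤n
indicator-*-≤ (s≤s z≤n) z≤n       _ = z≤n
indicator-*-≤ (s≤s z≤n) (s≤s z≤n) h = h z<s z<s

-- Writing `n = m + c` makes the difference of the two sides the square `c * c`, without
-- subtraction.
m≤n⇒2mn≤m²+n² : ∀ {m n} → m ≤ n → 2 * (m * n) ≤ m * m + n * n
m≤n⇒2mn≤m²+n² {m} m≤n with m≤n⇒∃[o]m+o≡n m≤n
... | c , refl = ≤-trans (m≤m+n _ (c * c)) (≤-reflexive (square m c))
  where
  square : ∀ m c → 2 * (m * (m + c)) + c * c ≡ m * m + (m + c) * (m + c)
  square = solve-∀

2mn≤m²+n² : ∀ m n → 2 * (m * n) ≤ m * m + n * n
2mn≤m²+n² m n with ≤-total m n
... | inj₁ m≤n = m≤n⇒2mn≤m²+n² m≤n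
... | inj₂ n≤m = subst₂ _≤_ (cong (2 *_) (*-comm n m)) (+-comm (n * n) (m * m)) (m≤n⇒2mn≤m²+n² n≤m)

-- Covered and uncovered points of a twin-free neighborly code.

module TwinFreeCode {d n} {V : List (Word n)} (code : IsTwinFreeNeighborlyDCode d n V) where
  open IsTwinFreeNeighborlyDCode code

  size : ∀ {v} → v ∈ V → ∣ prop v ∣ ≡ d
  size = proj₂ dCode

  boxes-disjoint : ∀ {v w} x → v ∈ V → w ∈ V → 0 < χ v x → 0 < χ w x → v ≡ w
  boxes-disjoint {v} {w} x v∈ w∈ x∈v x∈w with ≡-dec _≟ᴸ_ v w
  ... | yes v≡w = v≡w
  ... | no  v≢w = let l , opp , _ = neighborlyCode v∈ w∈ v≢w in
    ⊥-elim (opposite⇒¬compat (lookup x l) opp (χ-pos v x x∈v l) (χ-pos w x x∈w l))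

  cover : Point n → ℕ
  cover x = ∑[ v ← V ] χ v x

  cover≤1 : ∀ x → cover x ≤ 1
  cover≤1 x = ∑≤1 (λ v → χ v x) unique (λ v → χ≤1 v x) (boxes-disjoint x)

  gap : Point n → ℕ
  gap x = 1 ∸ cover x

  cover+gap : ∀ x → cover x + gap x ≡ 1
  cover+gap x = m+[n∸m]≡n (cover≤1 x)

  -- Many boundary edges in every occurring direction.

  boundary : Fin n → ℕ
  boundary i = ∑[ x ← cube n ] (gap x * cover (flip i x))

  -- The box of `v` contributes one point. Any other `u` has a `∗` at some `j` in `prop v`; flipping
  -- `j` preserves both the fibre and the box of `u`, so `u` contributes an even number.
  fibre-meets-cover-oddly : ∀ {v} z → v ∈ V → ¬ 2 ∣ ∑[ x ← cube n ] (off v z x * cover x)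
  fibre-meets-cover-oddly {v} z v∈ 2∣ =
    ∑-odd (λ u → ∑[ x ← cube n ] (off v z x * χ u x)) unique v∈ one even (subst (2 ∣_) split 2∣)
    where
    split : ∑[ x ← cube n ] (off v z x * cover x) ≡ ∑[ u ← V ] ∑[ x ← cube n ] (off v z x * χ u x)
    split = trans (∑-cong (cube n) λ {x} _ → sym (∑-*ˡ (off v z x) V λ u → χ u x))
                  (∑-swap (cube n) V λ x u → off v z x * χ u x)

    one : ∑[ x ← cube n ] (off v z x * χ v x) ≡ 1
    one = trans (∑-cong (cube n) λ {x} _ → *-comm (off v z x) (χ v x)) (∑-χ-off v z)

    even : ∀ {u} → u ∈ V → v ≢ u → 2 ∣ ∑[ x ← cube n ] (off v z x * χ u x)
    even {u} u∈ v≢u =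
      let j , vⱼ , uⱼ = prop-differ {v = v} {u} (trans (size v∈) (sym (size u∈)))
                          (neighborlyCode v∈ u∈ v≢u) (withoutTwinPairs v∈ u∈)
      in flip-invariant⇒even j _ λ x → cong₂ _*_ (off-flip j v z x vⱼ) (χ-flip j u x uⱼ)

  -- A fibre contains an odd number of uncovered points, so flipping position i
  -- cannot pair them up.
  boundary-in-fibre : ∀ {v} i z → v ∈ V → 0 < fixed (lookup v i) →
                      0 < ∑[ x ← cube n ] (off v z x * (gap x * cover (flip i x)))
  boundary-in-fibre {v} i z v∈ vᵢ = n≢0⇒n>0 λ none → fibre-meets-cover-oddly z v∈
    (∣m+n∣m⇒∣n (subst (2 ∣_) split (flip-invariant⇒even i (off v z) λ x → off-flip i v z x vᵢ))
               (flip-invariant⇒even i (λ x → off v z x * gap x) (invariant none)))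
    where
    split : ∑ (cube n) (off v z) ≡
            ∑[ x ← cube n ] (off v z x * gap x) + ∑[ x ← cube n ] (off v z x * cover x)
    split = trans (∑-cong (cube n) λ {x} _ → begin
        off v z x                                     ≡⟨ *-identityʳ _ ⟨
        off v z x * 1                                 ≡⟨ cong (off v z x *_) (cover+gap x) ⟨
        off v z x * (cover x + gap x)                 ≡⟨ cong (off v z x *_) (+-comm (cover x) (gap x)) ⟩
        off v z x * (gap x + cover x)                 ≡⟨ *-distribˡ-+ (off v z x) (gap x) (cover x) ⟩
        off v z x * gap x + off v z x * cover x       ∎)
      (∑-+ (cube n) _ _)
      where open ≡-Reasoning

    -- Here `a` and `b` are the values of `cover` at `x` and `flip i x`, and `o` is the fibre
    -- indicator. The two vanishing products exclude a boundary edge in either orientation.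
    cases : ∀ {a b} o → a ≤ 1 → b ≤ 1 → o * ((1 ∸ a) * b) ≡ 0 → o * ((1 ∸ b) * a) ≡ 0 →
            o * (1 ∸ b) ≡ o * (1 ∸ a)
    cases o z≤n       z≤n       _ _ = refl
    cases o z≤n       (s≤s z≤n) h _ = trans (*-zeroʳ o) (sym h)
    cases o (s≤s z≤n) z≤n       _ h = trans h (sym (*-zeroʳ o))
    cases o (s≤s z≤n) (s≤s z≤n) _ _ = refl

    invariant : ∑[ x ← cube n ] (off v z x * (gap x * cover (flip i x))) ≡ 0 →
                ∀ x → off v z (flip i x) * gap (flip i x) ≡ off v z x * gap x
    invariant none x = trans (cong (_* gap (flip i x)) (off-flip i v z x vᵢ))
      (cases (off v z x) (cover≤1 x) (cover≤1 (flip i x)) (zero-at x)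
        (subst₂ (λ o y → o * (gap (flip i x) * cover y) ≡ 0)
          (off-flip i v z x vᵢ) (flip-involutive i x) (zero-at (flip i x))))
      where
      zero-at : ∀ y → off v z y * (gap y * cover (flip i y)) ≡ 0
      zero-at y = n≤0⇒n≡0 (≤-trans (≤∑-cube (λ y → off v z y * (gap y * cover (flip i y))) y)
                                   (≤-reflexive none))

  -- Each point `z` of the box of `v` names one fibre, and each fibre contains a boundary edge. The
  -- factor `2 ^ d` stands in for a division in `2^(n−d)`.
  boundary-lower : ∀ {v} i → v ∈ V → 0 < fixed (lookup v i) → 2 ^ n ≤ boundary i * 2 ^ d
  boundary-lower {v} i v∈ vᵢ = begin
    2 ^ n                                 ≡⟨ χ-volume v ⟨
    ∑ (cube n) (χ v) * 2 ^ ∣ prop v ∣     ≡⟨ cong (λ m → ∑ (cube n) (χ v) * 2 ^ m) (size v∈) ⟩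
    ∑ (cube n) (χ v) * 2 ^ d              ≤⟨ *-monoˡ-≤ (2 ^ d) (∑-mono (cube n) λ {z} _ →
                                               m≤m*n (χ v z) (fibre z) {{>-nonZero (boundary-in-fibre i z v∈ vᵢ)}}) ⟩
    ∑[ z ← cube n ] (χ v z * fibre z) * 2 ^ d ≡⟨ cong (_* 2 ^ d) regroup ⟩
    boundary i * 2 ^ d                    ∎
    where
    e : Point n → ℕ
    e x = gap x * cover (flip i x)

    fibre : Point n → ℕ
    fibre z = ∑[ x ← cube n ] (off v z x * e x)

    -- The fibres partition the cube: by the symmetry of `off`, each `x` lies in the fibre of
    -- exactly one `z` in the box of `v`.
    regroup : ∑[ z ← cube n ] (χ v z * fibre z) ≡ boundary i
    regroup = let open ≡-Reasoning in begin
      ∑[ z ← cube n ] (χ v z * fibre z)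
        ≡⟨ ∑-cong (cube n) (λ {z} _ → ∑-*ˡ (χ v z) (cube n) λ x → off v z x * e x) ⟨
      ∑[ z ← cube n ] ∑[ x ← cube n ] (χ v z * (off v z x * e x))
        ≡⟨ ∑-swap (cube n) (cube n) (λ z x → χ v z * (off v z x * e x)) ⟩
      ∑[ x ← cube n ] ∑[ z ← cube n ] (χ v z * (off v z x * e x))
        ≡⟨ ∑-cong (cube n) (λ {x} _ → begin
             ∑[ z ← cube n ] (χ v z * (off v z x * e x))
               ≡⟨ ∑-cong (cube n) (λ {z} _ → trans (sym (*-assoc (χ v z) (off v z x) (e x)))
                    (cong (λ o → χ v z * o * e x) (off-sym v z x))) ⟩
             ∑[ z ← cube n ] (χ v z * off v x z * e x)
               ≡⟨ ∑-*ʳ (e x) (cube n) (λ z → χ v z * off v x z) ⟩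
             ∑[ z ← cube n ] (χ v z * off v x z) * e x
               ≡⟨ cong (_* e x) (∑-χ-off v x) ⟩
             1 * e x
               ≡⟨ *-identityˡ (e x) ⟩
             e x ∎) ⟩
      boundary i ∎

    open ≤-Reasoning

  -- Few covered neighbours of an uncovered point.

  neighbour-fixed : ∀ {v} i x → cover x ≡ 0 → v ∈ V → 0 < χ v (flip i x) → 0 < fixed (lookup v i)
  neighbour-fixed {v} i x uncovered v∈ pos with lookup v i in eq
  ... | 𝟎 = z<s
  ... | 𝟏 = z<s
  ... | ∗ = contradiction uncovered
    (>⇒≢ (∑-pos⁺ (λ v → χ v x) v∈ (subst (0 <_) (χ-flip i v x eq) pos)))

  -- At a position other than `i` and `j` both boxes admit the letter of `x`, so distinct `v` and
  -- `w` must be opposite at `i` or at `j`, where both are then proper.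
  tournament : ∀ {v w} i j x → cover x ≡ 0 → v ∈ V → w ∈ V → 0 < χ v (flip i x) → 0 < χ w (flip j x) →
               0 < fixed (lookup v j) ⊎ 0 < fixed (lookup w i)
  tournament {v} {w} i j x uncovered v∈ w∈ v∋ w∋ with ≡-dec _≟ᴸ_ v w
  ... | yes refl = inj₁ (neighbour-fixed j x uncovered w∈ w∋)
  ... | no  v≢w with neighborlyCode v∈ w∈ v≢w
  ...   | l , opp , _ with l Fin.≟ i | l Fin.≟ j
  ...     | yes refl | _        = inj₂ (proj₂ (opposite⇒fixed opp))
  ...     | no _     | yes refl = inj₁ (proj₁ (opposite⇒fixed opp))
  ...     | no l≢i   | no l≢j   = ⊥-elim (opposite⇒¬compat (lookup x l) opp
    (subst (λ b → 0 < compat (lookup v l) b) (lookup∘updateAt′ l i l≢i x) (χ-pos v (flip i x) v∋ l))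
    (subst (λ b → 0 < compat (lookup w l) b) (lookup∘updateAt′ l j l≢j x) (χ-pos w (flip j x) w∋ l)))

  sensitivity : ∀ x → cover x ≡ 0 → ∑[ i ← allFin n ] cover (flip i x) ≤ 2 * d
  sensitivity x uncovered = bound m (begin
    m * m
      ≡⟨ ∑-*ʳ m is c ⟨
    ∑[ i ← is ] (c i * m)
      ≡⟨ ∑-cong is (λ {i} _ → ∑-*ˡ (c i) is c) ⟨
    ∑[ i ← is ] ∑[ j ← is ] (c i * c j)
      ≤⟨ ∑-mono is (λ {i} _ → ∑-mono is λ {j} _ → arc i j) ⟩
    ∑[ i ← is ] ∑[ j ← is ] (C i j + C j i)
      ≡⟨ ∑-cong is (λ {i} _ → ∑-+ is (C i) (λ j → C j i)) ⟩
    ∑[ i ← is ] (∑[ j ← is ] C i j + ∑[ j ← is ] C j i)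
      ≡⟨ ∑-+ is (λ i → ∑ is (C i)) (λ i → ∑[ j ← is ] C j i) ⟩
    ∑[ i ← is ] ∑[ j ← is ] C i j + ∑[ i ← is ] ∑[ j ← is ] C j i
      ≡⟨ cong₂ _+_ arcs (trans (∑-swap is is (λ i j → C j i)) arcs) ⟩
    m * d + m * d
      ≡⟨ double m d ⟩
    m * (2 * d) ∎)
    where
    open ≤-Reasoning
    is = allFin n
    c : Fin n → ℕ
    c i = cover (flip i x)
    m = ∑ is c
    C : Fin n → Fin n → ℕ
    -- The arcs from `i` to `j`: the word covering the neighbour in direction `i` is proper at `j`.
    -- Each covered neighbour emits `d` arcs, and every ordered pair of covered directions has an
    -- arc one way or the other, whence `m * m ≤ 2 * m * d`.
    C i j = ∑[ v ← V ] (χ v (flip i x) * fixed (lookup v j))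

    double : ∀ m d → m * d + m * d ≡ m * (2 * d)
    double = solve-∀

    bound : ∀ m → m * m ≤ m * (2 * d) → m ≤ 2 * d
    bound zero    _ = z≤n
    bound (suc m) h = *-cancelˡ-≤ (suc m) h

    arc : ∀ i j → c i * c j ≤ C i j + C j i
    arc i j = indicator-*-≤ (cover≤1 (flip i x)) (cover≤1 (flip j x)) λ cᵢ cⱼ →
      let v , v∈ , v∋ = ∑-pos V (λ v → χ v (flip i x)) cᵢ
          w , w∈ , w∋ = ∑-pos V (λ v → χ v (flip j x)) cⱼ
      in arc-pos v∈ w∈ v∋ w∋ (tournament i j x uncovered v∈ w∈ v∋ w∋)
      where
      arc-pos : ∀ {v w} → v ∈ V → w ∈ V → 0 < χ v (flip i x) → 0 < χ w (flip j x) →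
                 0 < fixed (lookup v j) ⊎ 0 < fixed (lookup w i) → 0 < C i j + C j i
      arc-pos v∈ w∈ v∋ w∋ (inj₁ vⱼ) = <-≤-trans (∑-pos⁺ _ v∈ (*-mono-≤ v∋ vⱼ)) (m≤m+n _ _)
      arc-pos v∈ w∈ v∋ w∋ (inj₂ wᵢ) = <-≤-trans (∑-pos⁺ _ w∈ (*-mono-≤ w∋ wᵢ)) (m≤n+m _ (C i j))

    arcs : ∑[ i ← is ] ∑[ j ← is ] C i j ≡ m * d
    arcs = trans (∑-cong is λ {i} _ → begin-equality
        ∑[ j ← is ] C i j
          ≡⟨ ∑-swap is V (λ j v → χ v (flip i x) * fixed (lookup v j)) ⟩
        ∑[ v ← V ] ∑[ j ← is ] (χ v (flip i x) * fixed (lookup v j))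
          ≡⟨ ∑-cong V (λ {v} v∈ → trans (∑-*ˡ (χ v (flip i x)) is λ j → fixed (lookup v j))
               (cong (χ v (flip i x) *_) (trans (∑-fixed v) (size v∈)))) ⟩
        ∑[ v ← V ] (χ v (flip i x) * d)
          ≡⟨ ∑-*ʳ d V (λ v → χ v (flip i x)) ⟩
        c i * d ∎)
      (∑-*ʳ d is c)

  boundary-upper : ∑ (allFin n) boundary ≤ 2 * d * ∑ (cube n) gap
  boundary-upper = begin
    ∑[ i ← allFin n ] ∑[ x ← cube n ] (gap x * cover (flip i x))
      ≡⟨ ∑-swap (allFin n) (cube n) (λ i x → gap x * cover (flip i x)) ⟩
    ∑[ x ← cube n ] ∑[ i ← allFin n ] (gap x * cover (flip i x))
      ≤⟨ ∑-mono (cube n) (λ {x} _ → ≤-trans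
           (≤-reflexive (∑-*ˡ (gap x) (allFin n) λ i → cover (flip i x))) (pointwise x)) ⟩
    ∑[ x ← cube n ] (2 * d * gap x)
      ≡⟨ ∑-*ˡ (2 * d) (cube n) gap ⟩
    2 * d * ∑ (cube n) gap ∎
    where
    open ≤-Reasoning
    pointwise : ∀ x → gap x * ∑[ i ← allFin n ] cover (flip i x) ≤ 2 * d * gap x
    pointwise x with cover x in eq
    -- Only uncovered points, where `gap x` is 1, have to be bounded; elsewhere `gap x` vanishes.
    ... | zero  = ≤-trans (≤-reflexive (*-identityˡ _))
                    (≤-trans (sensitivity x eq) (≤-reflexive (sym (*-identityʳ (2 * d)))))
    ... | suc m = ≤-trans (≤-reflexive (cong (_* ∑[ i ← allFin n ] cover (flip i x)) (0∸n≡0 m))) z≤n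

  -- Volumes of the code in the cube and in its halves.

  ∑-volumes : ∀ (F : Word n → Point n → ℕ) (c : Word n → ℕ) →
              (∀ {v} → v ∈ V → ∑ (cube n) (F v) * 2 ^ d ≡ c v * 2 ^ n) →
              ∑[ x ← cube n ] ∑[ v ← V ] F v x * 2 ^ d ≡ ∑ V c * 2 ^ n
  ∑-volumes F c h = begin
    ∑[ x ← cube n ] ∑[ v ← V ] F v x * 2 ^ d ≡⟨ cong (_* 2 ^ d) (∑-swap (cube n) V (λ x v → F v x)) ⟩
    ∑[ v ← V ] ∑ (cube n) (F v) * 2 ^ d      ≡⟨ ∑-*ʳ (2 ^ d) V (λ v → ∑ (cube n) (F v)) ⟨
    ∑[ v ← V ] (∑ (cube n) (F v) * 2 ^ d)    ≡⟨ ∑-cong V h ⟩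
    ∑[ v ← V ] (c v * 2 ^ n)                 ≡⟨ ∑-*ʳ (2 ^ n) V c ⟩
    ∑ V c * 2 ^ n                            ∎
    where open ≡-Reasoning

  cover-volume : ∑ (cube n) cover * 2 ^ d ≡ length V * 2 ^ n
  cover-volume = trans
    (∑-volumes χ (λ _ → 1) λ {v} v∈ →
      trans (cong (λ m → ∑ (cube n) (χ v) * 2 ^ m) (sym (size v∈)))
            (trans (χ-volume v) (sym (*-identityˡ (2 ^ n)))))
    (cong (_* 2 ^ n) (trans (∑-const 1 V) (*-identityʳ (length V))))

  -- Twice the share of the box of `v` that lies in the half-cube `xᵢ = b`.
  weight : Fin n → Bool → Word n → ℕ
  weight i b v = compat (lookup v i) b * 2 ^ fixed (lookup v i)

  -- Disjoint boxes cannot overfill the half-cube `xᵢ = b`.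
  ∑-weight : ∀ i b → ∑ V (weight i b) ≤ 2 ^ d
  ∑-weight i b = *-cancelʳ-≤ (∑ V (weight i b)) (2 ^ d) (2 ^ n) {{m^n≢0 2 n}} (begin
    ∑ V (weight i b) * 2 ^ n
      ≡⟨ ∑-volumes (λ v x → χ v (x [ i ]≔ b)) (weight i b) (λ {v} v∈ →
           trans (cong (λ m → ∑[ x ← cube n ] χ v (x [ i ]≔ b) * 2 ^ m) (sym (size v∈)))
                 (χ-half-volume i b v)) ⟨
    ∑[ x ← cube n ] cover (x [ i ]≔ b) * 2 ^ d
      ≤⟨ *-monoˡ-≤ (2 ^ d) (∑-mono (cube n) λ {x} _ → cover≤1 (x [ i ]≔ b)) ⟩
    ∑[ _ ← cube n ] 1 * 2 ^ d
      ≡⟨ cong (_* 2 ^ d) (cube-volume n) ⟩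
    2 ^ n * 2 ^ d
      ≡⟨ *-comm (2 ^ n) (2 ^ d) ⟩
    2 ^ d * 2 ^ n ∎)
    where open ≤-Reasoning

  -- Degrees of directions (the `sᵢ` of the overview) and opponents.

  degree : Fin n → ℕ
  degree i = ∑[ v ← V ] fixed (lookup v i)

  ∑-degree : ∑ (allFin n) degree ≡ length V * d
  ∑-degree = trans (∑-swap (allFin n) V λ i v → fixed (lookup v i))
    (trans (∑-cong V λ {v} v∈ → trans (∑-fixed v) (size v∈)) (∑-const d V))

  opponents : Word n → Fin n → ℕ
  opponents v i = ∑[ w ← V ] opposite (lookup v i) (lookup w i)

  -- By neighborliness each word of the code is opposite to `v` in at most one position.
  ∑-opponents : ∀ {v} → v ∈ V → ∑ (allFin n) (opponents v) ≤ length V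
  ∑-opponents {v} v∈ = begin
    ∑[ i ← allFin n ] ∑[ w ← V ] opposite (lookup v i) (lookup w i)
      ≡⟨ ∑-swap (allFin n) V (λ i w → opposite (lookup v i) (lookup w i)) ⟩
    ∑[ w ← V ] ∑[ i ← allFin n ] opposite (lookup v i) (lookup w i)
      ≤⟨ ∑-mono V (λ {w} w∈ → ∑≤1 _ (allFin⁺ n) (λ i → opposite≤1 (lookup v i) (lookup w i))
           λ {i} {j} _ _ oppᵢ oppⱼ → single w∈ (opposite-pos _ _ oppᵢ) (opposite-pos _ _ oppⱼ)) ⟩
    ∑[ _ ← V ] 1
      ≡⟨ trans (∑-const 1 V) (*-identityʳ (length V)) ⟩
    length V ∎
    where
    open ≤-Reasoning
    single : ∀ {w} → w ∈ V → ∀ {i j} → DichotomousAt v w i → DichotomousAt v w j → i ≡ j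
    single {w} w∈ {i} oppᵢ oppⱼ with ≡-dec _≟ᴸ_ v w
    ... | yes refl = ⊥-elim (opposite-irrefl (lookup v i) oppᵢ)
    ... | no  v≢w  = let _ , _ , uniq = neighborlyCode v∈ w∈ v≢w in trans (sym (uniq oppᵢ)) (uniq oppⱼ)

  -- Codes with at least `2 ^ d − k` words.

  module Deficiency (k : ℕ) (large : 2 ^ d ≤ length V + k) where

    N : ℕ
    N = length V

    gap-volume : ∑ (cube n) gap * 2 ^ d ≤ k * 2 ^ n
    gap-volume = +-cancelˡ-≤ (N * 2 ^ n) _ _ (begin
      N * 2 ^ n + ∑ (cube n) gap * 2 ^ d
        ≡⟨ cong (_+ ∑ (cube n) gap * 2 ^ d) cover-volume ⟨
      ∑ (cube n) cover * 2 ^ d + ∑ (cube n) gap * 2 ^ d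
        ≡⟨ *-distribʳ-+ (2 ^ d) (∑ (cube n) cover) (∑ (cube n) gap) ⟨
      (∑ (cube n) cover + ∑ (cube n) gap) * 2 ^ d
        ≡⟨ cong (_* 2 ^ d) (trans (sym (∑-+ (cube n) cover gap))
             (trans (∑-cong (cube n) λ {x} _ → cover+gap x) (cube-volume n))) ⟩
      2 ^ n * 2 ^ d
        ≤⟨ *-monoʳ-≤ (2 ^ n) large ⟩
      2 ^ n * (N + k)
        ≡⟨ trans (*-comm (2 ^ n) (N + k)) (*-distribʳ-+ (2 ^ n) N k) ⟩
      N * 2 ^ n + k * 2 ^ n ∎)
      where open ≤-Reasoning

    -- Summing `opposite-count` over the code gives `degree i + N` on the left; the half-cube on the
    -- side of `v` contributes at most `2 ^ d ≤ N + k`, and `N` cancels.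
    degree≤opponents : ∀ v i → 0 < fixed (lookup v i) → degree i ≤ k + 2 * opponents v i
    degree≤opponents v i vᵢ = +-cancelˡ-≤ N _ _ (begin
      N + degree i
        ≡⟨ +-comm N (degree i) ⟩
      degree i + N
        ≡⟨ cong (degree i +_) (trans (∑-const 1 V) (*-identityʳ N)) ⟨
      degree i + ∑[ _ ← V ] 1
        ≡⟨ ∑-+ V (λ w → fixed (lookup w i)) (λ _ → 1) ⟨
      ∑[ w ← V ] (fixed (lookup w i) + 1)
        ≡⟨ ∑-cong V (λ {w} _ → opposite-count (lookup v i) (lookup w i) vᵢ) ⟩
      ∑[ w ← V ] (weight i (bit (lookup v i)) w + 2 * opposite (lookup v i) (lookup w i))
        ≡⟨ ∑-+ V (weight i (bit (lookup v i))) (λ w → 2 * opposite (lookup v i) (lookup w i)) ⟩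
      ∑ V (weight i (bit (lookup v i))) + ∑[ w ← V ] (2 * opposite (lookup v i) (lookup w i))
        ≤⟨ +-mono-≤ (≤-trans (∑-weight i (bit (lookup v i))) large)
             (≤-reflexive (∑-*ˡ 2 V λ w → opposite (lookup v i) (lookup w i))) ⟩
      N + k + 2 * opponents v i
        ≡⟨ +-assoc N k (2 * opponents v i) ⟩
      N + (k + 2 * opponents v i) ∎)
      where open ≤-Reasoning

    -- One factor `degree i` is expanded as a sum over words. The row of `v` then runs over its `d`
    -- proper positions, each costing `k` plus twice the opponents there, and the opponents total at
    -- most `N`.
    ∑-degree² : ∑[ i ← allFin n ] (degree i * degree i) ≤ N * (d * k + 2 * N)
    ∑-degree² = begin
      ∑[ i ← is ] (degree i * degree i)
        ≡⟨ ∑-cong is (λ {i} _ → ∑-*ʳ (degree i) V λ v → fixed (lookup v i)) ⟨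
      ∑[ i ← is ] ∑[ v ← V ] (fixed (lookup v i) * degree i)
        ≡⟨ ∑-swap is V (λ i v → fixed (lookup v i) * degree i) ⟩
      ∑[ v ← V ] ∑[ i ← is ] (fixed (lookup v i) * degree i)
        ≤⟨ ∑-mono V row ⟩
      ∑[ _ ← V ] (d * k + 2 * N)
        ≡⟨ ∑-const (d * k + 2 * N) V ⟩
      N * (d * k + 2 * N) ∎
      where
      open ≤-Reasoning
      is = allFin n

      term : ∀ a {s t} → a ≤ 1 → (0 < a → s ≤ k + t) → a * s ≤ a * k + t
      term zero          _ _ = z≤n
      term (suc zero) {s} {t} _ h = ≤-trans (≤-reflexive (*-identityˡ s))
        (≤-trans (h z<s) (≤-reflexive (cong (_+ t) (sym (*-identityˡ k)))))
      term (suc (suc _)) (s≤s ()) _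

      fixed≤1 : ∀ a → fixed a ≤ 1
      fixed≤1 𝟎 = ≤-refl
      fixed≤1 𝟏 = ≤-refl
      fixed≤1 ∗ = z≤n

      row : ∀ {v} → v ∈ V → ∑[ i ← is ] (fixed (lookup v i) * degree i) ≤ d * k + 2 * N
      row {v} v∈ = begin
        ∑[ i ← is ] (fixed (lookup v i) * degree i)
          ≤⟨ ∑-mono is (λ {i} _ → term _ (fixed≤1 (lookup v i)) (degree≤opponents v i)) ⟩
        ∑[ i ← is ] (fixed (lookup v i) * k + 2 * opponents v i)
          ≡⟨ ∑-+ is (λ i → fixed (lookup v i) * k) (λ i → 2 * opponents v i) ⟩
        ∑[ i ← is ] (fixed (lookup v i) * k) + ∑[ i ← is ] (2 * opponents v i)
          ≡⟨ cong₂ _+_ (trans (∑-*ʳ k is λ i → fixed (lookup v i))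
                              (cong (_* k) (trans (∑-fixed v) (size v∈))))
                       (∑-*ˡ 2 is (opponents v)) ⟩
        d * k + 2 * ∑ is (opponents v)
          ≤⟨ +-monoʳ-≤ (d * k) (*-monoʳ-≤ 2 (∑-opponents v∈)) ⟩
        d * k + 2 * N ∎

    -- Cauchy-Schwarz term by term. At most `2dk` directions share the total degree `dN`, so the
    -- balanced degree is `N / 2k`; hence the choice of `2 * k * s` and `N` in `2mn≤m²+n²`. The term
    -- `N * N` is charged to the boundary edges, which exist because `i` occurs.
    degree-bound : ∀ i → 4 * k * N * 2 ^ n * degree i ≤
                   4 * k * k * 2 ^ n * (degree i * degree i) + N * N * 2 ^ d * boundary i
    degree-bound i with degree i in eq
    ... | zero  = ≤-trans (≤-reflexive (*-zeroʳ (4 * k * N * 2 ^ n))) z≤n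
    ... | suc m =
      let v , v∈ , vᵢ = ∑-pos V (λ v → fixed (lookup v i)) (subst (0 <_) (sym eq) z<s)
      in begin
        4 * k * N * 2 ^ n * s                          ≡⟨ lhs k N (2 ^ n) s ⟩
        2 * (2 * k * s * N) * 2 ^ n                    ≤⟨ *-monoˡ-≤ (2 ^ n) (2mn≤m²+n² (2 * k * s) N) ⟩
        (2 * k * s * (2 * k * s) + N * N) * 2 ^ n      ≡⟨ mid k N (2 ^ n) s ⟩
        4 * k * k * 2 ^ n * (s * s) + N * N * 2 ^ n    ≤⟨ +-monoʳ-≤ (4 * k * k * 2 ^ n * (s * s))
                                                            (*-monoʳ-≤ (N * N) (boundary-lower i v∈ vᵢ)) ⟩
        4 * k * k * 2 ^ n * (s * s) + N * N * (boundary i * 2 ^ d)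
          ≡⟨ cong (4 * k * k * 2 ^ n * (s * s) +_) (rhs (N * N) (boundary i) (2 ^ d)) ⟩
        4 * k * k * 2 ^ n * (s * s) + N * N * 2 ^ d * boundary i ∎
      where
      open ≤-Reasoning
      s = suc m
      lhs : ∀ k N p s → 4 * k * N * p * s ≡ 2 * (2 * k * s * N) * p
      lhs = solve-∀
      mid : ∀ k N p s → (2 * k * s * (2 * k * s) + N * N) * p ≡ 4 * k * k * p * (s * s) + N * N * p
      mid = solve-∀
      rhs : ∀ a b c → a * (b * c) ≡ a * c * b
      rhs = solve-∀

    d≤6k : 0 < k → 0 < N → d * k ≤ N → d ≤ 6 * k
    d≤6k 0<k 0<N dk≤N = +-cancelʳ-≤ d d (6 * k)
      -- After cancelling this common factor, the summed bounds read `2d ≤ 6k + d`: the squares give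
      -- `6k`, as `dk + 2N ≤ 3N`, and the boundary gives `d`.
      (*-cancelˡ-≤ (2 * k * (N * N) * 2 ^ n) {{m*n≢0 _ _ {{m*n≢0 _ _ {{m*n≢0 2 k {{_}} {{>-nonZero 0<k}}}}
          {{m*n≢0 N N {{>-nonZero 0<N}} {{>-nonZero 0<N}}}}}} {{m^n≢0 2 n}}}} (begin
        2 * k * (N * N) * 2 ^ n * (d + d)
          ≡⟨ lhs k N (2 ^ n) d ⟩
        4 * k * N * 2 ^ n * (N * d)
          ≡⟨ trans (∑-*ˡ (4 * k * N * 2 ^ n) is degree) (cong (4 * k * N * 2 ^ n *_) ∑-degree) ⟨
        ∑[ i ← is ] (4 * k * N * 2 ^ n * degree i)
          ≤⟨ ∑-mono is (λ {i} _ → degree-bound i) ⟩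
        ∑[ i ← is ] (4 * k * k * 2 ^ n * (degree i * degree i) + N * N * 2 ^ d * boundary i)
          ≡⟨ trans (∑-+ is (λ i → 4 * k * k * 2 ^ n * (degree i * degree i)) (λ i → N * N * 2 ^ d * boundary i))
               (cong₂ _+_ (∑-*ˡ (4 * k * k * 2 ^ n) is λ i → degree i * degree i)
                          (∑-*ˡ (N * N * 2 ^ d) is boundary)) ⟩
        4 * k * k * 2 ^ n * ∑[ i ← is ] (degree i * degree i) + N * N * 2 ^ d * ∑ is boundary
          ≤⟨ +-mono-≤ (*-monoʳ-≤ (4 * k * k * 2 ^ n) (≤-trans ∑-degree² (*-monoʳ-≤ N (+-monoˡ-≤ (2 * N) dk≤N))))
                      (*-monoʳ-≤ (N * N * 2 ^ d) boundary-upper) ⟩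
        4 * k * k * 2 ^ n * (N * (N + 2 * N)) + N * N * 2 ^ d * (2 * d * ∑ (cube n) gap)
          ≡⟨ cong (4 * k * k * 2 ^ n * (N * (N + 2 * N)) +_) (mid N (2 ^ d) d (∑ (cube n) gap)) ⟩
        4 * k * k * 2 ^ n * (N * (N + 2 * N)) + 2 * d * (N * N) * (∑ (cube n) gap * 2 ^ d)
          ≤⟨ +-monoʳ-≤ (4 * k * k * 2 ^ n * (N * (N + 2 * N))) (*-monoʳ-≤ (2 * d * (N * N)) gap-volume) ⟩
        4 * k * k * 2 ^ n * (N * (N + 2 * N)) + 2 * d * (N * N) * (k * 2 ^ n)
          ≡⟨ rhs k N (2 ^ n) d ⟩
        2 * k * (N * N) * 2 ^ n * (6 * k + d) ∎))
      where
      open ≤-Reasoning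
      is = allFin n
      lhs : ∀ k N p d → 2 * k * (N * N) * p * (d + d) ≡ 4 * k * N * p * (N * d)
      lhs = solve-∀
      mid : ∀ N q d g → N * N * q * (2 * d * g) ≡ 2 * d * (N * N) * (g * q)
      mid = solve-∀
      rhs : ∀ k N p d → 4 * k * k * p * (N * (N + 2 * N)) + 2 * d * (N * N) * (k * p) ≡
                        2 * k * (N * N) * p * (6 * k + d)
      rhs = solve-∀

-- Exponential growth and the limit.

n<2^n : ∀ n → n < 2 ^ n
n<2^n zero    = z<s
n<2^n (suc n) = begin-strict
  suc n             ≤⟨ n<2^n n ⟩
  2 ^ n             <⟨ m<m+n (2 ^ n) (m^n>0 2 n) ⟩
  2 ^ n + 2 ^ n     ≡⟨ cong (2 ^ n +_) (+-identityʳ (2 ^ n)) ⟨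
  2 ^ suc n         ∎
  where open ≤-Reasoning

n*[1+n]≤4*2^n : ∀ n → n * suc n ≤ 4 * 2 ^ n
n*[1+n]≤4*2^n zero    = z≤n
n*[1+n]≤4*2^n (suc n) = begin
  suc n * suc (suc n)            ≡⟨ expand n ⟩
  n * suc n + 2 * suc n          ≤⟨ +-mono-≤ (n*[1+n]≤4*2^n n) (*-mono-≤ {2} {4} (s≤s (s≤s z≤n)) (n<2^n n)) ⟩
  4 * 2 ^ n + 4 * 2 ^ n          ≡⟨ collect (2 ^ n) ⟩
  4 * 2 ^ suc n                  ∎
  where
  open ≤-Reasoning
  expand : ∀ n → suc n * suc (suc n) ≡ n * suc n + 2 * suc n
  expand = solve-∀
  collect : ∀ p → 4 * p + 4 * p ≡ 4 * (2 * p)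
  collect = solve-∀

-- Otherwise `dk + k ≤ 2 ^ d < N + k`, where `N` is the length of `V`, so `dk ≤ N` and `d≤6k`
-- contradicts `6k < d`.
deficiency : ∀ {d n V} → IsTwinFreeNeighborlyDCode d n V → ∀ k → 0 < k → 6 * k < d → length V + k ≤ 2 ^ d
deficiency {d} {n} {V} code k 0<k 6k<d = ≮⇒≥ λ 2^d<N+k →
  let dk≤N = +-cancelʳ-≤ k (d * k) (length V) (≤-trans [1+d]k≤2^d (<⇒≤ 2^d<N+k))
      0<N  = <-≤-trans (*-mono-≤ (≤-trans (s≤s z≤n) 6k<d) 0<k) dk≤N
  in <⇒≱ 6k<d (TwinFreeCode.Deficiency.d≤6k code k (<⇒≤ 2^d<N+k) 0<k 0<N dk≤N)
  where
  open ≤-Reasoning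
  factor : ∀ d k → 6 * (d * k + k) ≡ 6 * k * suc d
  factor = solve-∀
  -- Multiplied by 6, the bound `6k < d` replaces `k` by `d`, and a quadratic is left to compare
  -- with `2 ^ d`.
  [1+d]k≤2^d : d * k + k ≤ 2 ^ d
  [1+d]k≤2^d = *-cancelˡ-≤ 6 (begin
    6 * (d * k + k) ≡⟨ factor d k ⟩
    6 * k * suc d   ≤⟨ *-monoˡ-≤ (suc d) (<⇒≤ 6k<d) ⟩
    d * suc d       ≤⟨ n*[1+n]≤4*2^n d ⟩
    4 * 2 ^ d       ≤⟨ *-monoˡ-≤ (2 ^ d) {4} {6} (s≤s (s≤s (s≤s (s≤s z≤n)))) ⟩
    6 * 2 ^ d       ∎)

open import Data.Integer.Base using (+_; _-_)

theorem2 : (M : ℕ → ℕ) →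
    (∀ d → 1 ≤ d → IsMaximalCardinality d (M d)) →
    TendsToInfinity (λ d → + (2 ^ d) - + (M d))
theorem2 M maximal K = suc (6 * k) , λ d D≤d →
  let _ , _ , code , length≡M = IsMaximalCardinality.attained (maximal d (≤-trans (s≤s z≤n) D≤d))
      k+M≤2^d = subst (_≤ 2 ^ d) (trans (cong (_+ k) length≡M) (+-comm (M d) k)) (deficiency code k z<s D≤d)
  in ℤ.≤-trans (≤+k K) (begin
       + k                            ≤⟨ ℤ.+≤+ (m+n≤o⇒m≤o∸n k k+M≤2^d) ⟩
       + (2 ^ d ∸ M d)                ≡⟨ ℤ.⊖-≥ (m+n≤o⇒n≤o k k+M≤2^d) ⟨
       2 ^ d ℤ.⊖ M d                  ≡⟨ ℤ.m-n≡m⊖n (2 ^ d) (M d) ⟨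
       + (2 ^ d) - + (M d)            ∎)
  where
  open ℤ.≤-Reasoning
  -- The successor makes `k` positive, as `deficiency` demands; the threshold `suc (6 * k)` is the
  -- strict inequality `6 * k < d`.
  k = suc ℤ.∣ K ∣
  ≤+k : ∀ K → K ℤ.≤ + suc ℤ.∣ K ∣
  ≤+k (+ m)      = ℤ.+≤+ (n≤1+n m)
  ≤+k ℤ.-[1+ m ] = ℤ.-≤+
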